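{- Let $r,k\geq 2$ and let $n\geq r+1$ be an integer with $n\nrightarrow(r+1)_k^r$. If a hypergraph $(V,E)$ admits a vertex colouring $V\to\{0,\dots,n-1\}$ under which no hyperedge of size $\geq r+1$ is monochromatic, then there is a colouring of the $r$-subsets of $V$ with $k+f(r)$ colours such that no hyperedge of size $\geq r+1$ is monochromatic (i.e. has all its $r$-subsets of the same colour), where $f(2)=1$, $f(3)=3$, $f(r)=4$ if $r\geq4$ and $r+1$ is prime, and $f(r)=5$ otherwise.
   Context: For $m\in\mathbb N$ write $[m]=\{0,\dots,m-1\}$. The relation $n\to(s)_k^r$ (for $n\geq s>r$, $k\geq2$) means that every colouring of the $r$-element subsets of $[n]$ with $k$ colours has a subset of $[n]$ of size $s$ all of whose $r$-subsets receive the same colour; $n\nrightarrow(s)_k^r$ is its negation. A vertex colouring makes a hyperedge monochromatic if all its vertices get the same colour. -}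

module Defs where

open import Level using (Level; _⊔_) renaming (suc to lsuc)
open import Data.Bool using (if_then_else_)
open import Data.Nat using (ℕ; suc; _≤?_)
open import Data.Nat.Primality using (prime?)
open import Data.Fin using (Fin)
open import Data.List using (List; length)
open import Data.List.Membership.Propositional using (_∈_)
open import Data.List.Relation.Unary.Unique.Propositional using (Unique)
open import Data.Product using (Σ-syntax)
open import Relation.Binary.PropositionalEquality using (_≡_)
open import Relation.Nullary.Decidable using (does; _×-dec_)
open import Relation.Unary using (Pred; _⊆_; _≐_)

private
  variable
    a ℓ ℓ′ : Level
    V : Set a
    m n r k : ℕ

-- An m-element subset of V is presented by a duplicate-free list of length m.
-- Different orderings present the same subset, so subsets are compared by
-- mutual inclusion of their membership predicates, never by _≡_.
record SubsetOfSize (m : ℕ) (V : Set a) : Set a where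
  field
    elements : List V
    unique   : Unique elements
    size     : length elements ≡ m

open SubsetOfSize public

⟦_⟧ : {V : Set a} → SubsetOfSize m V → Pred V a
⟦ S ⟧ x = x ∈ elements S

-- The field `cong` makes the colour depend only on the subset,
-- not on the list presenting it.
record SubsetColouring (r k : ℕ) (V : Set a) : Set a where
  field
    colour : SubsetOfSize r V → Fin k
    cong   : ∀ {S T} → ⟦ S ⟧ ≐ ⟦ T ⟧ → colour S ≡ colour T

open SubsetColouring public

MonochromaticSubsets : {V : Set a} → SubsetColouring r k V → Pred V ℓ → Set (a ⊔ ℓ)
MonochromaticSubsets χ A = ∀ S T → ⟦ S ⟧ ⊆ A → ⟦ T ⟧ ⊆ A → colour χ S ≡ colour χ T

MonochromaticVertices : {V : Set a} → (V → Fin n) → Pred V ℓ → Set (a ⊔ ℓ)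
MonochromaticVertices c A = ∀ x y → A x → A y → c x ≡ c y

-- A may be infinite, so "|A| ≥ m" is expressed as having an m-element subset.
SizeAtLeast : {V : Set a} → ℕ → Pred V ℓ → Set (a ⊔ ℓ)
SizeAtLeast {V = V} m A = Σ[ S ∈ SubsetOfSize m V ] ⟦ S ⟧ ⊆ A

-- n ⟶⟨ s ⟩[ r , k ] is the partition relation n → (s)ʳₖ.
_⟶⟨_⟩[_,_] : ℕ → ℕ → ℕ → ℕ → Set
n ⟶⟨ s ⟩[ r , k ] =
  (χ : SubsetColouring r k (Fin n)) →
  Σ[ H ∈ SubsetOfSize s (Fin n) ] MonochromaticSubsets χ ⟦ H ⟧

record Hypergraph (a ℓ ℓ′ : Level) : Set (lsuc (a ⊔ ℓ ⊔ ℓ′)) where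
  field
    Vertex    : Set a
    Hyperedge : Pred (Pred Vertex ℓ) ℓ′

open Hypergraph public

f : ℕ → ℕ
f 2 = 1
f 3 = 3
f r = if does (4 ≤? r ×-dec prime? (suc r)) then 4 else 5

{-# OPTIONS --safe #-}
-- Fix a colouring of the r-subsets of [n] with k colours and no monochromatic
-- (r+1)-set; it exists constructively because there are finitely many colourings.
-- An r-set S on which the vertex colouring c is injective gets the colour of c(S).
-- Otherwise let a be the multiplicity in S of the least colour used by S, and p
-- the number of colours used; S gets one of three new colours: "a even", or
-- "a odd" together with the parity of p.  Now take r+1 vertices of a hyperedge,
-- not all of the same colour.  If c is injective on them, the base colouring
-- separates two of their r-subsets.  Otherwise some colour is repeated.  If a ≥ 2,
-- dropping a vertex of the least colour changes the parity of a, whereas dropping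
-- any other vertex does not.  If a = 1, dropping the vertex of the least colour
-- changes p, whereas dropping one of a repeated colour changes neither a nor p.
-- Hence three new colours always suffice.  When r = 2, every non-injective pair
-- has a = 2, so one is enough.
module Submission where

open import Level using (Level)
open import Data.Bool using (Bool; true; false; if_then_else_)
open import Data.Fin using (Fin; zero; suc; _↑ˡ_; _↑ʳ_; inject≤; splitAt)
open import Data.Fin.Patterns using (0F; 1F; 2F)
open import Data.Fin.Properties as Fin
  using (any?; all?; ↑ˡ-injective; ↑ʳ-injective; inject≤-injective; splitAt-↑ˡ; splitAt-↑ʳ)
open import Data.Fin.Subset using (Subset; inside; outside; ∣_∣) renaming (_∈_ to _∈ˢ_)
open import Data.Fin.Subset.Properties using (anySubset?) renaming (_∈?_ to _∈ˢ?_)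
open import Data.List using (List; []; _∷_; _++_; length; map; foldr)
import Data.List.Membership.DecPropositional as DecMembership
open import Data.List.Membership.Propositional using (_∈_; _∉_; find)
open import Data.List.Membership.Propositional.Properties using (∈-∃++; ∈-map⁺; ∈-map⁻)
open import Data.List.Membership.Propositional.Properties.WithK using (unique∧set⇒bag)
open import Data.List.Properties using (length-map)
open import Data.List.Relation.Binary.BagAndSetEquality using (∼bag⇒↭)
open import Data.List.Relation.Binary.Permutation.Propositional
  using (_↭_; ↭-sym; ↭⇒↭ₛ)
  renaming (refl to ↭-refl; prep to ↭-prep; swap to ↭-swap; trans to ↭-trans)
open import Data.List.Relation.Binary.Permutation.Propositional.Properties
  using (shift; ↭-length; ∈-resp-↭; map⁺)
import Data.List.Relation.Binary.Permutation.Setoid.Properties as PermutationSetoid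
import Data.List.Relation.Binary.Subset.Propositional as List
open import Data.List.Relation.Unary.All as All using ([]; _∷_)
open import Data.List.Relation.Unary.AllPairs using ([]; _∷_)
open import Data.List.Relation.Unary.Any as Any using (here; there)
open import Data.List.Relation.Unary.Unique.Propositional using (Unique)
import Data.List.Relation.Unary.Unique.Propositional.Properties as Unique
open import Data.Nat using (ℕ; zero; suc; _+_; _≤_; _<_; _≥_; z≤n; s≤s; _≟_; parity)
open import Data.Nat.Properties
  using (≤-refl; ≤-reflexive; ≤-trans; ≤∧≢⇒<; <-≤-trans; <-irrefl; n≤1+n;
         m≤n+m; +-suc; +-comm; suc-injective; n≤0⇒n≡0; ≤-pred)
open import Data.Parity using (Parity; 0ℙ; 1ℙ)
open import Data.Parity.Properties using (suc-homo-⁻¹; p≢p⁻¹)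
open import Data.Product using (Σ-syntax; ∃; ∃₂; _×_; _,_; proj₁; proj₂)
open import Data.Vec as Vec using (Vec; []; _∷_; replicate; updateAt; sum; _[_]≔_; here; there)
open import Data.Vec.Properties using (updateAt-commutes)
open import Function using (_∘_; mk⇔)
open import Relation.Binary.PropositionalEquality
  using (_≡_; _≢_; refl; sym; trans; subst; cong; setoid)
open import Relation.Nullary using (¬_; Dec; yes; no; contradiction)
open import Relation.Nullary.Decidable using (decidable-stable; map′; ¬?; _×-dec_; _→-dec_)
open import Relation.Unary using (Pred; Decidable; _⊆_; _≐_)
open import Defs hiding (cong)

private
  variable
    a ℓ : Level
    A : Set a
    k m n r : ℕ

-- Duplicate-free lists

∈⇒↭∷ : ∀ {x : A} {xs} → x ∈ xs → ∃ λ ys → xs ↭ x ∷ ys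
∈⇒↭∷ {x = x} x∈xs with ys , zs , refl ← ∈-∃++ x∈xs = ys ++ zs , shift x ys zs

Unique-resp-↭ : {xs ys : List A} → xs ↭ ys → Unique xs → Unique ys
Unique-resp-↭ xs↭ys = PermutationSetoid.Unique-resp-↭ (setoid _) (↭⇒↭ₛ xs↭ys)

length-mono : {xs ys : List A} → Unique xs → xs List.⊆ ys → length xs ≤ length ys
length-mono []            _     = z≤n
length-mono {xs = x ∷ xs} (x≢xs ∷ xs!) xs⊆ys with ys′ , ys↭ ← ∈⇒↭∷ (xs⊆ys (here refl)) =
  ≤-trans (s≤s (length-mono xs! xs⊆ys′)) (≤-reflexive (sym (↭-length ys↭)))
  where
  xs⊆ys′ : xs List.⊆ ys′
  xs⊆ys′ y∈xs with ∈-resp-↭ ys↭ (xs⊆ys (there y∈xs))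
  ... | here refl  = contradiction refl (All.lookup x≢xs y∈xs)
  ... | there y∈ys = y∈ys

_∈?_ : (i : Fin n) (is : List (Fin n)) → Dec (i ∈ is)
_∈?_ = DecMembership._∈?_ Fin._≟_

⊆∧length≤⇒⊇ : {xs ys : List (Fin n)} → Unique xs → xs List.⊆ ys → length ys ≤ length xs →
  ys List.⊆ xs
⊆∧length≤⇒⊇ {xs = xs} {ys} xs! xs⊆ys ys≤xs {y} y∈ys with y ∈? xs
... | yes y∈xs = y∈xs
... | no  y∉xs = contradiction (<-≤-trans (length-mono y∷xs! y∷xs⊆ys) ys≤xs) (<-irrefl refl)
  where
  y∷xs! : Unique (y ∷ xs)
  y∷xs! = All.tabulate (λ { z∈xs refl → y∉xs z∈xs }) ∷ xs!
  y∷xs⊆ys : (y ∷ xs) List.⊆ ys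
  y∷xs⊆ys (here refl)  = y∈ys
  y∷xs⊆ys (there z∈xs) = xs⊆ys z∈xs

-- Without duplicates, equal membership forces equal multiplicities, hence a permutation. This lets
-- colours computed from lists depend on subsets only.
elements-↭ : {V : Set a} {S T : SubsetOfSize r V} → ⟦ S ⟧ ≐ ⟦ T ⟧ → elements S ↭ elements T
elements-↭ {S = S} {T} (S⊆T , T⊆S) =
  ∼bag⇒↭ (unique∧set⇒bag (unique S) (unique T) (mk⇔ S⊆T T⊆S))

-- The membership proof locates `x`; equality on `V` may be undecidable.
remove : {V : Set a} (S : SubsetOfSize (suc r) V) {x : V} → ⟦ S ⟧ x →
  Σ[ T ∈ SubsetOfSize r V ] elements S ↭ x ∷ elements T
remove S x∈S with ys , S↭ ← ∈⇒↭∷ x∈S with _ ∷ ys! ← Unique-resp-↭ S↭ (unique S) =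
  record
    { elements = ys
    ; unique   = ys!
    ; size     = suc-injective (trans (sym (↭-length S↭)) (size S)) } , S↭

member : {V : Set a} (S : SubsetOfSize (suc r) V) → ∃ ⟦ S ⟧
member record { elements = x ∷ _ } = x , here refl

-- Subsets of Fin n

toList : Subset n → List (Fin n)
toList []            = []
toList (inside  ∷ p) = zero ∷ map suc (toList p)
toList (outside ∷ p) = map suc (toList p)

length-toList : (p : Subset n) → length (toList p) ≡ ∣ p ∣
length-toList []            = refl
length-toList (inside  ∷ p) = cong suc (trans (length-map suc (toList p)) (length-toList p))
length-toList (outside ∷ p) = trans (length-map suc (toList p)) (length-toList p)

toList-unique : (p : Subset n) → Unique (toList p)
toList-unique []            = []
toList-unique (inside  ∷ p) =
  All.tabulate (λ { 0∈ refl → zero∉ 0∈ }) ∷ Unique.map⁺ Fin.suc-injective (toList-unique p)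
  where
  zero∉ : zero ∉ map suc (toList p)
  zero∉ 0∈ with _ , _ , () ← ∈-map⁻ suc 0∈
toList-unique (outside ∷ p) = Unique.map⁺ Fin.suc-injective (toList-unique p)

∈-toList⁺ : {p : Subset n} → (_∈ˢ p) ⊆ (_∈ toList p)
∈-toList⁺ {p = inside  ∷ p} here       = here refl
∈-toList⁺ {p = inside  ∷ p} (there i∈) = there (∈-map⁺ suc (∈-toList⁺ i∈))
∈-toList⁺ {p = outside ∷ p} (there i∈) = ∈-map⁺ suc (∈-toList⁺ i∈)

∈-toList⁻ : {p : Subset n} → (_∈ toList p) ⊆ (_∈ˢ p)
∈-toList⁻ {p = inside  ∷ p} (here refl) = here
∈-toList⁻ {p = inside  ∷ p} (there i∈) with j , j∈ , refl ← ∈-map⁻ suc i∈ = there (∈-toList⁻ j∈)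
∈-toList⁻ {p = outside ∷ p} i∈ with j , j∈ , refl ← ∈-map⁻ suc i∈ = there (∈-toList⁻ j∈)

listing : (p : Subset n) → ∣ p ∣ ≡ m → SubsetOfSize m (Fin n)
listing p ∣p∣≡m = record
  { elements = toList p ; unique = toList-unique p ; size = trans (length-toList p) ∣p∣≡m }

_∖_ : Subset n → Fin n → Subset n
p ∖ i = p [ i ]≔ outside

∣∖∣ : {p : Subset n} {i : Fin n} → i ∈ˢ p → suc ∣ p ∖ i ∣ ≡ ∣ p ∣
∣∖∣ here                      = refl
∣∖∣ (there {y = inside}  i∈p) = cong suc (∣∖∣ i∈p)
∣∖∣ (there {y = outside} i∈p) = ∣∖∣ i∈p

∈-∖ : {p : Subset n} {i j : Fin n} → j ∈ˢ p → j ≢ i → j ∈ˢ p ∖ i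
∈-∖ {i = zero}  here       j≢i = contradiction refl j≢i
∈-∖ {i = suc i} here       j≢i = here
∈-∖ {i = zero}  (there j∈) j≢i = there j∈
∈-∖ {i = suc i} (there j∈) j≢i = there (∈-∖ j∈ (j≢i ∘ cong suc))

two≤∣∣ : {p : Subset n} {i j : Fin n} → i ∈ˢ p → j ∈ˢ p → i ≢ j → 2 ≤ ∣ p ∣
two≤∣∣ {p = p} {i} {j} i∈p j∈p i≢j =
  subst (2 ≤_) (length-toList p)
    (length-mono {xs = i ∷ j ∷ []} ((i≢j ∷ []) ∷ [] ∷ [])
      λ { (here refl) → ∈-toList⁺ i∈p ; (there (here refl)) → ∈-toList⁺ j∈p })

-- Counting yields an element of `H` outside `S`; then `S` lies in `H ∖ i` and has the same size.
-- Pairs of `r`-subsets of `H` thus become pairs of elements.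
omitted : (H : Subset n) → ∣ H ∣ ≡ suc r → (S : SubsetOfSize r (Fin n)) → ⟦ S ⟧ ⊆ (_∈ˢ H) →
  ∃ λ i → i ∈ˢ H × ⟦ S ⟧ ≐ (_∈ˢ H ∖ i)
omitted {n} {r} H ∣H∣≡ S S⊆H with any? (λ i → i ∈ˢ? H ×-dec ¬? (i ∈? elements S))
... | no ¬∃ = contradiction H≤r (<-irrefl refl ∘ subst (_≤ r) ∣H∣≡)
  where
  H⊆S : toList H List.⊆ elements S
  H⊆S {j} j∈ = decidable-stable (j ∈? elements S) λ j∉ → ¬∃ (j , ∈-toList⁻ j∈ , j∉)
  H≤r : ∣ H ∣ ≤ r
  H≤r = subst (∣ H ∣ ≤_) (size S)
    (subst (_≤ length (elements S)) (length-toList H) (length-mono (toList-unique H) H⊆S))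
... | yes (i , i∈H , i∉S) = i , i∈H , S⊆ , ∖⊆S ∘ ∈-toList⁺
  where
  S⊆ : ⟦ S ⟧ ⊆ (_∈ˢ H ∖ i)
  S⊆ j∈S = ∈-∖ (S⊆H j∈S) λ { refl → i∉S j∈S }
  ∖⊆S : toList (H ∖ i) List.⊆ elements S
  ∖⊆S = ⊆∧length≤⇒⊇ (unique S) (∈-toList⁺ ∘ S⊆)
    (≤-reflexive (trans (length-toList (H ∖ i))
      (trans (suc-injective (trans (∣∖∣ i∈H) ∣H∣≡)) (sym (size S)))))

-- Colourings of all subsets of Fin n, in a form that can be searched

-- A function on subsets, stored as a binary tree branching on each membership, so that exhaustive
-- search works without function extensionality.
Table : ℕ → ℕ → Set
Table k zero    = Fin k
Table k (suc n) = Table k n × Table k n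

lookup : Table k n → Subset n → Fin k
lookup t         []            = t
lookup (t₁ , t₂) (inside  ∷ p) = lookup t₁ p
lookup (t₁ , t₂) (outside ∷ p) = lookup t₂ p

tabulate : (Subset n → Fin k) → Table k n
tabulate {zero}  g = g []
tabulate {suc n} g = tabulate (g ∘ (inside ∷_)) , tabulate (g ∘ (outside ∷_))

lookup∘tabulate : (g : Subset n → Fin k) (p : Subset n) → lookup (tabulate g) p ≡ g p
lookup∘tabulate g []            = refl
lookup∘tabulate g (inside  ∷ p) = lookup∘tabulate (g ∘ (inside ∷_)) p
lookup∘tabulate g (outside ∷ p) = lookup∘tabulate (g ∘ (outside ∷_)) p

anyTable? : {P : Pred (Table k n) ℓ} → Decidable P → Dec (∃ P)
anyTable? {n = zero}  P? = any? P?
anyTable? {n = suc n} P? =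
  map′ (λ { (t₁ , t₂ , p) → (t₁ , t₂) , p }) (λ { ((t₁ , t₂) , p) → t₁ , t₂ , p })
    (anyTable? λ t₁ → anyTable? λ t₂ → P? (t₁ , t₂))

ConstantBelow : Table k n → Subset n → Set
ConstantBelow t H = ∀ i j → i ∈ˢ H → j ∈ˢ H → lookup t (H ∖ i) ≡ lookup t (H ∖ j)

Homogeneous : ℕ → Table k n → Pred (Subset n) _
Homogeneous r t H = ∣ H ∣ ≡ suc r × ConstantBelow t H

homogeneous? : ∀ r (t : Table k n) → Decidable (Homogeneous r t)
homogeneous? r t H = ∣ H ∣ ≟ suc r ×-dec
  all? λ i → all? λ j → i ∈ˢ? H →-dec (j ∈ˢ? H →-dec lookup t (H ∖ i) Fin.≟ lookup t (H ∖ j))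

-- Homogeneity of an (r+1)-set reads only sets of size `r`, so the default colour at other sizes has
-- no effect.
colourSubset : Fin k → SubsetColouring r k (Fin n) → Subset n → Fin k
colourSubset {r = r} default χ p with ∣ p ∣ ≟ r
... | yes ∣p∣≡r = colour χ (listing p ∣p∣≡r)
... | no  _     = default

colourSubset-≐ : ∀ default (χ : SubsetColouring r k (Fin n)) {S p} →
  ⟦ S ⟧ ≐ (_∈ˢ p) → ∣ p ∣ ≡ r → colourSubset default χ p ≡ colour χ S
colourSubset-≐ {r = r} default χ {S} {p} (S⊆p , p⊆S) ∣p∣≡r with ∣ p ∣ ≟ r
... | yes eq    = SubsetColouring.cong χ {listing p eq} {S} (p⊆S ∘ ∈-toList⁻ , ∈-toList⁺ ∘ S⊆p)
... | no  ∣p∣≢r = contradiction ∣p∣≡r ∣p∣≢r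

-- A refuted partition relation does not by itself hand over a bad colouring; exhaustive search
-- does. If every table had a homogeneous set, tabulating an arbitrary `χ` would prove the relation.
avoidingTable : Fin k → ¬ (n ⟶⟨ suc r ⟩[ r , k ]) →
  Σ[ t ∈ Table k n ] ¬ ∃ (Homogeneous r t)
avoidingTable {k} {n} {r} default n↛
  with anyTable? (λ t → ¬? (anySubset? (homogeneous? r t)))
... | yes avoiding  = avoiding
... | no  ¬avoiding = contradiction arrow n↛
  where
  arrow : n ⟶⟨ suc r ⟩[ r , k ]
  arrow χ
    with H , ∣H∣≡ , const ←
           decidable-stable (anySubset? (homogeneous? r (tabulate (colourSubset default χ))))
             (λ none → ¬avoiding (tabulate (colourSubset default χ) , none))
    = listing H ∣H∣≡ , mono
    where
    value : ∀ {S i} → ⟦ S ⟧ ≐ (_∈ˢ H ∖ i) → i ∈ˢ H →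
      lookup (tabulate (colourSubset default χ)) (H ∖ i) ≡ colour χ S
    value {S} {i} S≐ i∈H = trans (lookup∘tabulate (colourSubset default χ) (H ∖ i))
      (colourSubset-≐ default χ {S} S≐ (suc-injective (trans (∣∖∣ i∈H) ∣H∣≡)))
    mono : MonochromaticSubsets χ ⟦ listing H ∣H∣≡ ⟧
    mono S T S⊆H T⊆H =
      let i , i∈H , S≐ = omitted H ∣H∣≡ S (∈-toList⁻ ∘ S⊆H)
          j , j∈H , T≐ = omitted H ∣H∣≡ T (∈-toList⁻ ∘ T⊆H)
      in trans (sym (value {S} S≐ i∈H)) (trans (const i j i∈H j∈H) (value {T} T≐ j∈H))

-- Multiplicity vectors

increment : Fin n → Vec ℕ n → Vec ℕ n
increment i v = updateAt v i suc

increment-injective : ∀ (i : Fin n) {v w} → increment i v ≡ increment i w → v ≡ w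
increment-injective zero    {_ ∷ _} {_ ∷ _} refl = refl
increment-injective (suc i) {x ∷ v} {y ∷ w} eq
  with refl ← cong Vec.head eq = cong (x ∷_) (increment-injective i (cong Vec.tail eq))

increment-commutes : ∀ (i j : Fin n) v → increment i (increment j v) ≡ increment j (increment i v)
increment-commutes i j v with i Fin.≟ j
... | yes refl = refl
... | no  i≢j  = updateAt-commutes i j i≢j v

sum-increment : ∀ (i : Fin n) v → sum (increment i v) ≡ suc (sum v)
sum-increment zero    (x ∷ v) = refl
sum-increment (suc i) (x ∷ v) = trans (cong (x +_) (sum-increment i v)) (+-suc x (sum v))

sum-replicate-0 : ∀ n → sum (replicate n 0) ≡ 0
sum-replicate-0 zero    = refl
sum-replicate-0 (suc n) = sum-replicate-0 n

isPositive : ℕ → Bool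
isPositive zero    = outside
isPositive (suc _) = inside

support : Vec ℕ n → Subset n
support = Vec.map isPositive

∈-support-increment : ∀ (i : Fin n) v → i ∈ˢ support (increment i v)
∈-support-increment zero    (x ∷ v) = here
∈-support-increment (suc i) (x ∷ v) = there (∈-support-increment i v)

∈-support-increment⁻ : ∀ {i} (j : Fin n) v → i ≢ j → i ∈ˢ support (increment j v) → i ∈ˢ support v
∈-support-increment⁻ zero    (x ∷ v) i≢j here       = contradiction refl i≢j
∈-support-increment⁻ zero    (x ∷ v) i≢j (there i∈) = there i∈
∈-support-increment⁻ (suc j) (suc x ∷ v) i≢j here       = here
∈-support-increment⁻ (suc j) (x ∷ v) i≢j (there i∈) =
  there (∈-support-increment⁻ j v (i≢j ∘ cong suc) i∈)

∉-support-replicate-0 : ∀ {i : Fin n} → ¬ i ∈ˢ support (replicate n 0)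
∉-support-replicate-0 (there i∈) = ∉-support-replicate-0 i∈

-- Equality holds exactly when all entries are at most 1, that is, when no colour repeats; strict
-- inequality expresses a repetition below.
∣support∣≤sum : (v : Vec ℕ n) → ∣ support v ∣ ≤ sum v
∣support∣≤sum []          = z≤n
∣support∣≤sum (zero  ∷ v) = ∣support∣≤sum v
∣support∣≤sum (suc x ∷ v) = s≤s (≤-trans (∣support∣≤sum v) (m≤n+m (sum v) x))

∣support∣≡0⇒sum≡0 : (v : Vec ℕ n) → ∣ support v ∣ ≡ 0 → sum v ≡ 0
∣support∣≡0⇒sum≡0 []         _  = refl
∣support∣≡0⇒sum≡0 (zero ∷ v) eq = ∣support∣≡0⇒sum≡0 v eq

-- Junk value 0 for the zero vector.
leastMultiplicity : Vec ℕ n → ℕ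
leastMultiplicity []          = 0
leastMultiplicity (zero  ∷ v) = leastMultiplicity v
leastMultiplicity (suc x ∷ v) = suc x

leastMultiplicity≡sum : (v : Vec ℕ n) → ∣ support v ∣ ≤ 1 → leastMultiplicity v ≡ sum v
leastMultiplicity≡sum []          _ = refl
leastMultiplicity≡sum (zero  ∷ v) p = leastMultiplicity≡sum v p
leastMultiplicity≡sum (suc x ∷ v) (s≤s p)
  rewrite ∣support∣≡0⇒sum≡0 v (n≤0⇒n≡0 p) = cong suc (+-comm 0 x)

multiplicities : List (Fin n) → Vec ℕ n
multiplicities = foldr increment (replicate _ 0)

sum-multiplicities : (is : List (Fin n)) → sum (multiplicities is) ≡ length is
sum-multiplicities {n} []       = sum-replicate-0 n
sum-multiplicities     (i ∷ is) =
  trans (sum-increment i (multiplicities is)) (cong suc (sum-multiplicities is))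

multiplicities-↭ : {is js : List (Fin n)} → is ↭ js → multiplicities is ≡ multiplicities js
multiplicities-↭ ↭-refl          = refl
multiplicities-↭ (↭-prep i p)    = cong (increment i) (multiplicities-↭ p)
multiplicities-↭ (↭-swap {xs = is} i j p) =
  trans (increment-commutes i j (multiplicities is))
    (cong (increment j ∘ increment i) (multiplicities-↭ p))
multiplicities-↭ (↭-trans p q)   = trans (multiplicities-↭ p) (multiplicities-↭ q)

∈-support⁺ : {is : List (Fin n)} {i : Fin n} → i ∈ is → i ∈ˢ support (multiplicities is)
∈-support⁺ {i = i} i∈is with js , is↭ ← ∈⇒↭∷ i∈is =
  subst (λ v → i ∈ˢ support v) (sym (multiplicities-↭ is↭)) (∈-support-increment i _)

∈-support⁻ : {is : List (Fin n)} {i : Fin n} → i ∈ˢ support (multiplicities is) → i ∈ is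
∈-support⁻ {is = []}     i∈ = contradiction i∈ ∉-support-replicate-0
∈-support⁻ {is = j ∷ is} {i} i∈ with i Fin.≟ j
... | yes refl = here refl
... | no  i≢j  = there (∈-support⁻ (∈-support-increment⁻ j (multiplicities is) i≢j i∈))

-- Deleting one vertex, seen on multiplicity vectors

Predecessor : Vec ℕ n → Pred (Vec ℕ n) _
Predecessor v w = ∃ λ i → increment i w ≡ v

sum-predecessor : {v w : Vec ℕ n} → Predecessor v w → suc (sum w) ≡ sum v
sum-predecessor {w = w} (i , refl) = sym (sum-increment i w)

∷-predecessor : ∀ {x} {v w : Vec ℕ n} → Predecessor v w → Predecessor (x ∷ v) (x ∷ w)
∷-predecessor {x = x} (i , eq) = suc i , cong (x ∷_) eq

predecessor : (v : Vec ℕ n) → 1 ≤ ∣ support v ∣ → ∃ (Predecessor v)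
predecessor (zero  ∷ v) p with w , v⋗w ← predecessor v p = zero ∷ w , ∷-predecessor v⋗w
predecessor (suc x ∷ v) _ = x ∷ v , zero , refl

-- Some entry is at least 2; lowering the first such entry leaves it positive.
predecessor-same-support : (v : Vec ℕ n) → ∣ support v ∣ < sum v →
  ∃ λ w → Predecessor v w × support w ≡ support v
predecessor-same-support (zero ∷ v) p with w , v⋗w , eq ← predecessor-same-support v p =
  zero ∷ w , ∷-predecessor v⋗w , cong (outside ∷_) eq
predecessor-same-support (suc zero ∷ v) (s≤s p) with w , v⋗w , eq ← predecessor-same-support v p =
  suc zero ∷ w , ∷-predecessor v⋗w , cong (inside ∷_) eq
predecessor-same-support (suc (suc x) ∷ v) _ = suc x ∷ v , (zero , refl) , refl

∣support∣≢suc[+sum] : ∀ x (v : Vec ℕ n) → ∣ support v ∣ ≢ suc (x + sum v)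
∣support∣≢suc[+sum] x v eq = <-irrefl eq (s≤s (≤-trans (∣support∣≤sum v) (m≤n+m (sum v) x)))

-- All entries are at most 1, so lowering a positive one makes it vanish.
predecessor-at : (v : Vec ℕ n) → ∣ support v ∣ ≡ sum v → ∀ {i} → i ∈ˢ support v →
  ∃ λ w → increment i w ≡ v × support w ≡ support v ∖ i
predecessor-at (suc zero ∷ v) _ here = zero ∷ v , refl , refl
predecessor-at (suc (suc x) ∷ v) eq here =
  contradiction (suc-injective eq) (∣support∣≢suc[+sum] x v)
predecessor-at (zero ∷ v) eq (there i∈) with w , refl , eq′ ← predecessor-at v eq i∈ =
  zero ∷ w , refl , cong (outside ∷_) eq′
predecessor-at (suc zero ∷ v) eq (there i∈)
  with w , refl , eq′ ← predecessor-at v (suc-injective eq) i∈ =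
  suc zero ∷ w , refl , cong (inside ∷_) eq′
predecessor-at (suc (suc x) ∷ v) eq (there i∈) =
  contradiction (suc-injective eq) (∣support∣≢suc[+sum] x v)

-- The three new colours

-- The first parity can always be recovered, the second only when the first is odd.
code : Parity → Parity → Fin 3
code 0ℙ _  = 0F
code 1ℙ 0ℙ = 1F
code 1ℙ 1ℙ = 2F

code-injectiveˡ : ∀ p q {p′ q′} → code p p′ ≡ code q q′ → p ≡ q
code-injectiveˡ 0ℙ 0ℙ _ = refl
code-injectiveˡ 1ℙ 1ℙ _ = refl
code-injectiveˡ 0ℙ 1ℙ {q′ = 0ℙ} ()
code-injectiveˡ 0ℙ 1ℙ {q′ = 1ℙ} ()
code-injectiveˡ 1ℙ 0ℙ {p′ = 0ℙ} ()
code-injectiveˡ 1ℙ 0ℙ {p′ = 1ℙ} ()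

code-injectiveʳ : ∀ p′ q′ → code 1ℙ p′ ≡ code 1ℙ q′ → p′ ≡ q′
code-injectiveʳ 0ℙ 0ℙ _ = refl
code-injectiveʳ 1ℙ 1ℙ _ = refl

parity-suc : ∀ x → parity (suc x) ≢ parity x
parity-suc x eq = p≢p⁻¹ (parity (suc x)) (trans eq (sym (suc-homo-⁻¹ x)))

newColour : Vec ℕ n → Fin 3
newColour v = code (parity (leastMultiplicity v)) (parity ∣ support v ∣)

-- Only `w′` is claimed to repeat a colour: `w` may be injective, and then its base colour differs
-- from any new colour.
separated : (v : Vec ℕ n) → 2 ≤ ∣ support v ∣ → ∣ support v ∣ < sum v →
  ∃₂ λ w w′ → Predecessor v w × Predecessor v w′ ×
    ∣ support w′ ∣ < sum w′ × newColour w ≢ newColour w′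
separated (zero ∷ v) 2≤ ∣v∣<
  with w , w′ , v⋗w , v⋗w′ , ∣w′∣< , w≢w′ ← separated v 2≤ ∣v∣< =
  zero ∷ w , zero ∷ w′ , ∷-predecessor v⋗w , ∷-predecessor v⋗w′ , ∣w′∣< , w≢w′
separated (suc zero ∷ v) 2≤ (s≤s ∣v∣<)
  with w , v⋗w , eq ← predecessor-same-support v ∣v∣< =
  suc zero ∷ w , zero ∷ v , ∷-predecessor v⋗w , (zero , refl) , ∣v∣< , w≢0∷v
  where
  w≢0∷v : newColour (suc zero ∷ w) ≢ newColour (zero ∷ v)
  w≢0∷v same rewrite eq
    -- Equal codes force the least multiplicity of `v` to be odd as well, so both codes record the
    -- parity of the support sizes, which differ by one.
    with p ← code-injectiveˡ 1ℙ (parity (leastMultiplicity v)) same rewrite sym p =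
    parity-suc ∣ support v ∣ (code-injectiveʳ _ _ same)
-- A second colour occurs in `v`; lowering it keeps the head, while lowering the head flips its
-- parity.
separated (suc (suc x) ∷ v) (s≤s 1≤) _ with w , v⋗w ← predecessor v 1≤ =
  suc x ∷ v , suc (suc x) ∷ w , (zero , refl) , ∷-predecessor v⋗w ,
  s≤s (s≤s (≤-trans (∣support∣≤sum w) (m≤n+m (sum w) x))) ,
  λ same → parity-suc x (code-injectiveˡ (parity (suc x)) (parity x) same)

Colliding : ℕ → Pred (Vec ℕ n) _
Colliding r v = sum v ≡ r × ∣ support v ∣ ≢ r

-- A map of the new colours into `m` colours that confuses none of those occurring on non-injective
-- `r`-sets.
Palette : ℕ → ℕ → Set
Palette r m = Σ[ g ∈ (Fin 3 → Fin m) ] (∀ {n} (v w : Vec ℕ n) →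
  Colliding r v → Colliding r w → g (newColour v) ≡ g (newColour w) → newColour v ≡ newColour w)

palette-≥3 : 3 ≤ m → Palette r m
palette-≥3 3≤m = (λ i → inject≤ i 3≤m) , λ _ _ _ _ → inject≤-injective 3≤m 3≤m _ _

-- All values of `f` from 3 on are at least 3. For `r = 2` a colliding vector has one positive
-- entry, equal to 2, so only the code `0F` occurs.
palette : r ≥ 2 → Palette r (f r)
palette {1} (s≤s ())
palette {2} _ = (λ _ → zero) , λ v w v-collides w-collides _ →
  trans (newColour≡0 v v-collides) (sym (newColour≡0 w w-collides))
  where
  newColour≡0 : (v : Vec ℕ n) → Colliding 2 v → newColour v ≡ 0F
  newColour≡0 v (sum≡2 , ∣v∣≢2)
    with ∣v∣≤1 ← ≤-pred (≤∧≢⇒< (subst (∣ support v ∣ ≤_) sum≡2 (∣support∣≤sum v)) ∣v∣≢2)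
    rewrite leastMultiplicity≡sum v ∣v∣≤1 | sum≡2 = refl
palette {3} _ = palette-≥3 ≤-refl
palette {suc (suc (suc (suc r)))} _ = palette-≥3 (3≤if _)
  where
  3≤if : ∀ b → 3 ≤ (if b then 4 else 5)
  3≤if true  = s≤s (s≤s (s≤s z≤n))
  3≤if false = s≤s (s≤s (s≤s z≤n))

-- The colouring of multiplicity vectors

module _ (r : ℕ) (t : Table k n) (g : Fin 3 → Fin m) where

  -- When the sum is `r`, support size `r` means that no colour repeats.
  colourOf : Vec ℕ n → Fin (k + m)
  colourOf v with ∣ support v ∣ ≟ r
  ... | yes _ = lookup t (support v) ↑ˡ m
  ... | no  _ = k ↑ʳ g (newColour v)

  colourOf-injective : ∀ v → ∣ support v ∣ ≡ r → colourOf v ≡ lookup t (support v) ↑ˡ m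
  colourOf-injective v ∣v∣≡r with ∣ support v ∣ ≟ r
  ... | yes _ = refl
  ... | no ∣v∣≢r = contradiction ∣v∣≡r ∣v∣≢r

  -- Base and new colours occupy disjoint ranges of `Fin (k + m)`, so one colliding vector forces
  -- the other to collide.
  colourOf-colliding : ∀ v w → ∣ support w ∣ ≢ r → colourOf v ≡ colourOf w →
    ∣ support v ∣ ≢ r × g (newColour v) ≡ g (newColour w)
  colourOf-colliding v w ∣w∣≢r eq with ∣ support v ∣ ≟ r | ∣ support w ∣ ≟ r
  ... | _         | yes ∣w∣≡r = contradiction ∣w∣≡r ∣w∣≢r
  ... | no  ∣v∣≢r | no _      = ∣v∣≢r , ↑ʳ-injective k _ _ eq
  ... | yes _     | no _
    with () ← trans (sym (splitAt-↑ˡ k _ m)) (trans (cong (splitAt k) eq) (splitAt-↑ʳ k m _))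

MonochromaticPredecessors : {B : Set} → (Vec ℕ n → B) → Vec ℕ n → Set
MonochromaticPredecessors h v = ∀ {w w′} → Predecessor v w → Predecessor v w′ → h w ≡ h w′

-- If a colour repeats, `separated` gives two predecessors of different colours. If none does, the
-- support would be homogeneous for `t`.
not-monochromatic : {t : Table k n} → ¬ ∃ (Homogeneous r t) → (P : Palette r m) →
  (v : Vec ℕ n) → sum v ≡ suc r → 2 ≤ ∣ support v ∣ →
  ¬ MonochromaticPredecessors (colourOf r t (proj₁ P)) v
not-monochromatic {r = r} {m = m} {t = t} avoids (g , g-inj) v sum≡ 2≤ mono
  with ∣ support v ∣ ≟ sum v
... | no ∣v∣≢sum
  with w , w′ , v⋗w , v⋗w′ , ∣w′∣< , w≢w′ ← separated v 2≤ (≤∧≢⇒< (∣support∣≤sum v) ∣v∣≢sum)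
  = w≢w′ (g-inj w w′ (sum≡r v⋗w , proj₁ collision) (sum≡r v⋗w′ , ∣w′∣≢r) (proj₂ collision))
  where
  sum≡r : Predecessor v ⊆ λ w → sum w ≡ r
  sum≡r v⋗w = suc-injective (trans (sum-predecessor v⋗w) sum≡)
  ∣w′∣≢r : ∣ support w′ ∣ ≢ r
  ∣w′∣≢r eq = <-irrefl (trans eq (sym (sum≡r v⋗w′))) ∣w′∣<
  collision : ∣ support w ∣ ≢ r × g (newColour w) ≡ g (newColour w′)
  collision = colourOf-colliding r t g w w′ ∣w′∣≢r (mono v⋗w v⋗w′)
... | yes ∣v∣≡sum = avoids (support v , trans ∣v∣≡sum sum≡ , const)
  where
  value : ∀ {i w} → i ∈ˢ support v → support w ≡ support v ∖ i →
    colourOf r t g w ≡ lookup t (support v ∖ i) ↑ˡ m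
  value {w = w} i∈ eq = trans
    (colourOf-injective r t g w
      (trans (cong ∣_∣ eq) (suc-injective (trans (∣∖∣ i∈) (trans ∣v∣≡sum sum≡)))))
    (cong (λ p → lookup t p ↑ˡ m) eq)
  const : ConstantBelow t (support v)
  const i j i∈ j∈
    with w , v⋗w , eq ← predecessor-at v ∣v∣≡sum i∈ | w′ , v⋗w′ , eq′ ← predecessor-at v ∣v∣≡sum j∈
    = ↑ˡ-injective m _ _
        (trans (sym (value i∈ eq)) (trans (mono (i , v⋗w) (j , v⋗w′)) (value j∈ eq′)))

-- Vertex colourings

module _ {V : Set a} (c : V → Fin n) where

  profile : SubsetOfSize r V → Vec ℕ n
  profile S = multiplicities (map c (elements S))

  profile-cong : {S T : SubsetOfSize r V} → ⟦ S ⟧ ≐ ⟦ T ⟧ → profile S ≡ profile T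
  profile-cong {S = S} {T} S≐T = multiplicities-↭ (map⁺ c (elements-↭ {S = S} {T} S≐T))

  sum-profile : (S : SubsetOfSize r V) → sum (profile S) ≡ r
  sum-profile S =
    trans (sum-multiplicities (map c (elements S))) (trans (length-map c (elements S)) (size S))

  -- The lowered colour has positive multiplicity, so some vertex of `S` bears it and can be
  -- deleted.
  realise-predecessor : (S : SubsetOfSize (suc r) V) {w : Vec ℕ n} → Predecessor (profile S) w →
    Σ[ T ∈ SubsetOfSize r V ] ⟦ T ⟧ ⊆ ⟦ S ⟧ × profile T ≡ w
  realise-predecessor S {w} (i , eq)
    with i∈ ← subst (λ v → i ∈ˢ support v) eq (∈-support-increment i w)
    with x , x∈S , refl ← ∈-map⁻ c (∈-support⁻ i∈)
    with T , S↭ ← remove S x∈S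
    = T , ∈-resp-↭ (↭-sym S↭) ∘ there ,
      increment-injective (c x) (trans (sym (multiplicities-↭ (map⁺ c S↭))) (sym eq))

  colours-≥2 : (S : SubsetOfSize r V) {x y : V} → ⟦ S ⟧ x → ⟦ S ⟧ y → c x ≢ c y →
    2 ≤ ∣ support (profile S) ∣
  colours-≥2 S x∈S y∈S = two≤∣∣ (∈-support⁺ (∈-map⁺ c x∈S)) (∈-support⁺ (∈-map⁺ c y∈S))

  -- Either `S` already has two colours, or all of it has the colour of `s`; then exchanging `s` for
  -- `z` helps, as `r ≥ 1` leaves another vertex of that colour.
  bichromatic : {A : Pred V ℓ} {z : V} → r ≥ 1 → (S : SubsetOfSize (suc r) V) → ⟦ S ⟧ ⊆ A →
    A z → ∀ {s} → ⟦ S ⟧ s → c z ≢ c s →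
    Σ[ T ∈ SubsetOfSize (suc r) V ] ⟦ T ⟧ ⊆ A × 2 ≤ ∣ support (profile T) ∣
  bichromatic {z = z} r≥1 S S⊆A z∈A {s} s∈S cz≢cs
    with Any.any? (λ p → ¬? (c p Fin.≟ c s)) (elements S)
  ... | yes some with p , p∈S , cp≢cs ← find some = S , S⊆A , colours-≥2 S p∈S s∈S cp≢cs
  ... | no  none with remove S s∈S
  ...   | record { elements = []    ; size = refl } , S↭ with () ← r≥1
  ...   | T@record { elements = y ∷ _ } , S↭ =
    z∷T , z∷T⊆A , colours-≥2 z∷T (here refl) (there (here refl)) cz≢cy
    where
    T⊆S : ⟦ T ⟧ ⊆ ⟦ S ⟧
    T⊆S = ∈-resp-↭ (↭-sym S↭) ∘ there
    cz≢ : ∀ {p} → ⟦ T ⟧ p → c z ≢ c p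
    cz≢ {p} p∈T cz≡cp = none (Any.map (λ { refl cp≡cs → cz≢cs (trans cz≡cp cp≡cs) }) (T⊆S p∈T))
    cz≢cy : c z ≢ c y
    cz≢cy = cz≢ (here refl)
    z∷T : SubsetOfSize _ V
    z∷T = record
      { elements = z ∷ elements T
      -- The colour of `z` shows that it is new.
      ; unique   = All.tabulate (λ { p∈T refl → cz≢ p∈T refl }) ∷ unique T
      ; size     = cong suc (size T) }
    z∷T⊆A : ⟦ z∷T ⟧ ⊆ _
    z∷T⊆A (here refl)  = z∈A
    z∷T⊆A (there p∈T) = S⊆A (T⊆S p∈T)

theorem4p3 : ∀ {a ℓ ℓ′} (r k n : ℕ) → r ≥ 2 → k ≥ 2 → n ≥ r + 1 →
    ¬ (n ⟶⟨ r + 1 ⟩[ r , k ]) →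
    (G : Hypergraph a ℓ ℓ′) →
    (Σ[ c ∈ (Vertex G → Fin n) ]
    (∀ e → Hyperedge G e → SizeAtLeast (r + 1) e → ¬ MonochromaticVertices c e)) →
    Σ[ χ ∈ SubsetColouring r (k + f r) (Vertex G) ]
    (∀ e → Hyperedge G e → SizeAtLeast (r + 1) e → ¬ MonochromaticSubsets χ e)
theorem4p3 r k n r≥2 (s≤s _) _ n↛ G (c , c-proper) rewrite +-comm r 1
  -- Matching on `k ≥ 2` exposes `k` as a successor, so `zero` is available as the default colour.
  with t , avoids ← avoidingTable zero n↛
  with P@(g , _) ← palette r≥2
  = χ , proper
  where
  χ : SubsetColouring r (k + f r) (Vertex G)
  χ = record
    { colour = colourOf r t g ∘ profile c
    ; cong   = λ {S} {T} S≐T → cong (colourOf r t g) (profile-cong c {S = S} {T} S≐T) }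

  proper : ∀ e → Hyperedge G e → SizeAtLeast (suc r) e → ¬ MonochromaticSubsets χ e
  proper e e∈E (S , S⊆e) mono with s , s∈S ← member S =
    c-proper e e∈E (S , S⊆e) λ x y x∈e y∈e →
      trans (same-colour s∈S x∈e) (sym (same-colour s∈S y∈e))
    where
    -- Equality of colours is decidable, so refuting a difference suffices.
    same-colour : ∀ {s x} → ⟦ S ⟧ s → e x → c x ≡ c s
    same-colour {s} {x} s∈S x∈e = decidable-stable (c x Fin.≟ c s) λ cx≢cs →
      let T , T⊆e , 2≤ = bichromatic c (≤-trans (n≤1+n 1) r≥2) S S⊆e x∈e s∈S cx≢cs
      in not-monochromatic avoids P (profile c T) (sum-profile c T) 2≤ λ v⋗w v⋗w′ →
           let R  , R⊆T  , eq  = realise-predecessor c T v⋗w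
               R′ , R′⊆T , eq′ = realise-predecessor c T v⋗w′
           in trans (cong (colourOf r t g) (sym eq))
                (trans (mono R R′ (T⊆e ∘ R⊆T) (T⊆e ∘ R′⊆T)) (cong (colourOf r t g) eq′))
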